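{- For every positive integer $k$ there exists a finite tree $T'_{(k)}$ such that $\gamma_t(T'_{(k)})-\tau(T'_{(k)})=k$.
   Context: A vertex cover of a graph $G=(V,E)$ is a set $X\subseteq V$ such that each edge is incident to at least one vertex of $X$; $\tau(G)$ is the minimum cardinality of a vertex cover of $G$. A total dominating set of $G$ is a dominating set $D\subseteq V$ such that the subgraph induced by $D$ has no isolated vertices (equivalently, every vertex of $G$ has a neighbor in $D$); $\gamma_t(G)$ is the minimum cardinality of a total dominating set of $G$ (defined for graphs without isolated vertices). -}

module Defs where

open import Data.Fin.Base using (Fin; zero; suc; inject₁; fromℕ)
open import Data.Fin.Subset using (Subset; _∈_; _∉_; ∣_∣)
open import Data.Nat.Base using (ℕ; _+_; _≤_)
open import Data.Product.Base using (∃-syntax; _×_)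
open import Data.Sum.Base using (_⊎_)
open import Function.Definitions using (Injective)
open import Level using (0ℓ)
open import Relation.Binary.Core using (Rel)
open import Relation.Binary.Construct.Closure.ReflexiveTransitive using (Star)
open import Relation.Binary.Definitions using (Symmetric; Decidable)
open import Relation.Binary.PropositionalEquality.Core using (_≡_)
open import Relation.Nullary.Negation.Core using (¬_)

-- Finite simple graphs with vertex set Fin n.
record Graph (n : ℕ) : Set₁ where
  field
    Adj     : Rel (Fin n) 0ℓ
    adj?    : Decidable Adj
    adj-sym : Symmetric Adj
    no-loop : ∀ {v} → ¬ Adj v v

module _ {n : ℕ} (G : Graph n) where
  open Graph G

  -- An element of Star Adj u v is a walk from u to v.
  Connected : Set
  Connected = ∀ u v → Star Adj u v

  -- A cycle c₀ c₁ … c_{l+2} c₀, of length at least 3.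
  record Cycle : Set where
    field
      {l}      : ℕ
      vertex   : Fin (3 + l) → Fin n
      distinct : Injective _≡_ _≡_ vertex
      step     : ∀ (i : Fin (2 + l)) → Adj (vertex (inject₁ i)) (vertex (suc i))
      close    : Adj (vertex (fromℕ (2 + l))) (vertex zero)

  record IsTree : Set where
    field
      root      : Fin n -- the null graph is not a tree
      connected : Connected
      acyclic   : ¬ Cycle

  IsVertexCover : Subset n → Set
  IsVertexCover X = ∀ {u v} → Adj u v → u ∈ X ⊎ v ∈ X

  HasNeighbourIn : Subset n → Fin n → Set
  HasNeighbourIn D v = ∃[ u ] u ∈ D × Adj v u

  IsDominating : Subset n → Set
  IsDominating D = ∀ {v} → v ∉ D → HasNeighbourIn D v

  -- The second component says that the subgraph induced by D has no isolated
  -- vertices.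
  IsTotalDominating : Subset n → Set
  IsTotalDominating D = IsDominating D × (∀ {v} → v ∈ D → HasNeighbourIn D v)

IsMinimumCardinality : ∀ {n} → (Subset n → Set) → ℕ → Set
IsMinimumCardinality P m = (∃[ X ] P X × ∣ X ∣ ≡ m) × (∀ X → P X → m ≤ ∣ X ∣)

-- τ and γₜ as relations: [ G ]τ≡ m reads "τ(G) = m" and [ G ]γₜ≡ m reads
-- "γₜ(G) is defined and equals m". The latter fails for every m when G has an
-- isolated vertex, since G then has no total dominating set.
[_]τ≡_ : ∀ {n} → Graph n → ℕ → Set
[ G ]τ≡ m = IsMinimumCardinality (IsVertexCover G) m

[_]γₜ≡_ : ∀ {n} → Graph n → ℕ → Set
[ G ]γₜ≡ m = IsMinimumCardinality (IsTotalDominating G) m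

{-# OPTIONS --safe #-}

-- Take k copies of the path b – a – c – a′ – b′ and string them together by
-- joining the vertices a of consecutive copies, the first a being joined to one
-- extra vertex. The vertices a, a′ of all the copies form a vertex cover, which is
-- minimum because the edges ab and a′b′ are disjoint, so τ = 2k. The vertices
-- a, c, a′ of all the copies form a total dominating set, which is minimum because
-- b, b′ and a′ have pairwise disjoint neighbourhoods inside their copy, so γₜ = 3k.
module Submission where

open import Defs
open import Data.Integer.Base using (+_; _-_)
open import Data.Nat.Base using (ℕ; NonZero)
open import Data.Product.Base using (Σ-syntax; ∃-syntax; _×_)
open import Relation.Binary.PropositionalEquality.Core using (_≡_)

open import Data.Empty using (⊥)
open import Data.Fin.Base using (Fin; zero; suc; punchOut; inject₁)
open import Data.Fin.Properties using (_≟_; suc-injective; punchIn-punchOut; punchOut-injective)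
open import Data.Fin.Relation.Unary.Top using (view; ‵fromℕ; ‵inject₁)
open import Data.Fin.Subset using (Subset; _∈_; ∣_∣; inside; outside)
open import Data.Fin.Subset.Properties using (_∈?_; ∣p∣≤∣x∷p∣)
open import Data.Integer.Base using (_⊖_)
open import Data.Integer.Properties using ([+m]-[+n]≡m⊖n; ⊖-≥)
open import Data.Nat.Base using (suc; zero; _+_; _*_; _∸_; _≤_; z≤n; s≤s)
open import Data.Nat.Properties using (≤-trans; *-suc; m≤n+m; m+n∸n≡m)
open import Data.Product.Base using (_,_)
open import Data.Sum.Base using (_⊎_; inj₁; inj₂)
open import Data.Vec.Base using ([]; _∷_; here; there)
open import Function.Base using (_∘_; id)
open import Relation.Binary.Construct.Closure.ReflexiveTransitive using (ε; _◅_; _◅◅_; gmap)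
open import Relation.Binary.PropositionalEquality
  using (_≢_; refl; sym; trans; cong; subst₂; module ≡-Reasoning)
open import Relation.Nullary using (¬_; Dec; yes; no; contradiction)

open Graph using (Adj; adj?; adj-sym; no-loop)

module _ {n} {G : Graph n} (C : Cycle G) where
  open Cycle C

  -- Used to keep cycles off leaves, which have a single neighbour. The two vertices are the cyclic
  -- predecessor and successor; length at least 3 makes them different.
  twoNeighboursOnCycle : ∀ i → ∃[ p ] ∃[ q ]
    p ≢ q × Adj G (vertex i) (vertex p) × Adj G (vertex i) (vertex q)
  twoNeighboursOnCycle zero = suc zero , _ , (λ ()) , step zero , adj-sym G close
  twoNeighboursOnCycle (suc i) with view i
  ... | ‵fromℕ     = _ , zero , (λ ()) , adj-sym G (step i) , close
  ... | ‵inject₁ j = _ , suc (suc j) , distinctNeighbours j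
                   , adj-sym G (step i) , step (suc j)
    where
    distinctNeighbours : ∀ {m} (j : Fin m) → inject₁ (inject₁ j) ≢ suc (suc j)
    distinctNeighbours (suc j) eq = distinctNeighbours j (suc-injective eq)

singleton : Graph 1
singleton = record
  { Adj = λ _ _ → ⊥ ; adj? = λ _ _ → no id ; adj-sym = id ; no-loop = id }

singleton-isTree : IsTree singleton
singleton-isTree = record
  { root      = zero
  ; connected = λ { zero zero → ε }
  ; acyclic   = Cycle.close
  }

module _ {n} (G : Graph n) (v : Fin n) where

  addLeaf : Graph (suc n)
  addLeaf = record
    { Adj     = A
    ; adj?    = A?
    ; adj-sym = λ {u} {w} → A-sym {u} {w}
    ; no-loop = λ {u} → A-irrefl {u}
    }
    where
    A : Fin (suc n) → Fin (suc n) → Set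
    A zero    zero    = ⊥
    A zero    (suc u) = u ≡ v
    A (suc u) zero    = u ≡ v
    A (suc u) (suc w) = Adj G u w

    A? : ∀ u w → Dec (A u w)
    A? zero    zero    = no id
    A? zero    (suc u) = u ≟ v
    A? (suc u) zero    = u ≟ v
    A? (suc u) (suc w) = adj? G u w

    A-sym : ∀ {u w} → A u w → A w u
    A-sym {zero}  {suc _} = id
    A-sym {suc _} {zero}  = id
    A-sym {suc _} {suc _} = adj-sym G

    A-irrefl : ∀ {u} → ¬ A u u
    A-irrefl {suc _} = no-loop G

  addLeaf-leaf : ∀ {u} → Adj addLeaf zero u → u ≡ suc v
  addLeaf-leaf {suc _} = cong suc

  -- At the new leaf both cycle neighbours would be `suc v`, so a cycle avoids `zero` and pulls back
  -- to `G` along `suc`.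
  addLeaf-acyclic : ¬ Cycle G → ¬ Cycle addLeaf
  addLeaf-acyclic acyclic C = acyclic record
    { vertex   = λ i → punchOut (avoidsLeaf i)
    ; distinct = λ eq → distinct (punchOut-injective (avoidsLeaf _) (avoidsLeaf _) eq)
    ; step     = λ i → restrict (step i)
    ; close    = restrict close
    }
    where
    open Cycle C

    avoidsLeaf : ∀ i → zero ≢ vertex i
    avoidsLeaf i eq with twoNeighboursOnCycle C i
    ... | p , q , p≢q , ip , iq rewrite sym eq =
      p≢q (distinct (trans (addLeaf-leaf ip) (sym (addLeaf-leaf iq))))

    restrict : ∀ {i j} → Adj addLeaf (vertex i) (vertex j) →
               Adj G (punchOut (avoidsLeaf i)) (punchOut (avoidsLeaf j))
    -- `punchIn zero` computes to `suc`, so after this rewriting adjacency in `addLeaf` reduces to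
    -- adjacency in `G`.
    restrict = subst₂ (Adj addLeaf) (sym (punchIn-punchOut (avoidsLeaf _)))
                                    (sym (punchIn-punchOut (avoidsLeaf _)))

  addLeaf-connected : Connected G → Connected addLeaf
  addLeaf-connected conn zero    zero    = ε
  addLeaf-connected conn zero    (suc w) = zero-v ◅ gmap suc id (conn v w)
    where
    zero-v : Adj addLeaf zero (suc v)
    zero-v = refl
  addLeaf-connected conn (suc u) zero    = gmap suc id (conn u v) ◅◅ (v-zero ◅ ε)
    where
    v-zero : Adj addLeaf (suc v) zero
    v-zero = refl
  addLeaf-connected conn (suc u) (suc w) = gmap suc id (conn u w)

  addLeaf-isTree : IsTree G → IsTree addLeaf
  addLeaf-isTree t = record
    { root      = zero
    ; connected = addLeaf-connected (IsTree.connected t)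
    ; acyclic   = addLeaf-acyclic (IsTree.acyclic t)
    }

-- Each new leaf takes index `zero` and shifts the others, so the indices run in reverse order of
-- attachment.
pattern b′ = zero
pattern a′ = suc zero
pattern b  = suc (suc zero)
pattern c  = suc (suc (suc zero))
pattern a  = suc (suc (suc (suc zero)))
pattern old v = suc (suc (suc (suc (suc v))))

pattern b′∈  = here
pattern a′∈  = there here
pattern b∈   = there (there here)
pattern c∈   = there (there (there here))
pattern a∈   = there (there (there (there here)))
pattern old∈ p = there (there (there (there (there p))))

-- A record rather than a synonym, so that p can be inferred from m ≼ p.
record _≼_ {n} (m : ℕ) (p : Subset n) : Set where
  constructor ⟨_⟩
  field cardinality≥ : m ≤ ∣ p ∣

open _≼_ using (cardinality≥)

keep : ∀ {m n} {p : Subset n} → m ≼ p → suc m ≼ (inside ∷ p)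
keep ⟨ m≤∣p∣ ⟩ = ⟨ s≤s m≤∣p∣ ⟩

skip : ∀ {m n x} {p : Subset n} → m ≼ p → m ≼ (x ∷ p)
skip {x = x} {p} ⟨ m≤∣p∣ ⟩ = ⟨ ≤-trans m≤∣p∣ (∣p∣≤∣x∷p∣ x p) ⟩

-- Unlike total domination, this property, with v the vertex a of the last copy,
-- survives the restriction of D to the tree without its last copy.
DominatesAllBut : ∀ {n} → Graph n → Fin n → Subset n → Set
DominatesAllBut G v D = ∀ u → u ≢ v → HasNeighbourIn G D u

module _ {n} (G : Graph n) (v : Fin n) where

  -- The leaves are added in the order a, c, b, a′, b′.
  attachPath : Graph (5 + n)
  attachPath = addLeaf (addLeaf (addLeaf (addLeaf (addLeaf G v)
    zero) (suc zero)) (suc zero)) zero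

  attachPath-isTree : IsTree G → IsTree attachPath
  attachPath-isTree =
    addLeaf-isTree _ _ ∘ addLeaf-isTree _ _ ∘ addLeaf-isTree _ _ ∘
    addLeaf-isTree _ _ ∘ addLeaf-isTree _ _

  coverExtension : Subset n → Subset (5 + n)
  coverExtension X = outside ∷ inside ∷ outside ∷ outside ∷ inside ∷ X

  coverExtension-cover : ∀ {X} → IsVertexCover G X →
                         IsVertexCover attachPath (coverExtension X)
  coverExtension-cover cov {a′}            _ = inj₁ a′∈
  coverExtension-cover cov {a}             _ = inj₁ a∈
  coverExtension-cover cov {b′}    {a′}    _ = inj₂ a′∈
  coverExtension-cover cov {b}     {a}     _ = inj₂ a∈
  coverExtension-cover cov {c}     {a}     _ = inj₂ a∈
  coverExtension-cover cov {c}     {a′}    _ = inj₂ a′∈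
  coverExtension-cover cov {old _} {a}     _ = inj₂ a∈
  coverExtension-cover cov {old _} {old _} e with cov e
  ... | inj₁ u∈X = inj₁ (old∈ u∈X)
  ... | inj₂ w∈X = inj₂ (old∈ w∈X)

  -- A cover of the extended graph restricts to a cover of `G`. The edges from `b′` to `a′` and from
  -- `b` to `a` avoid the old vertices and each other, so they cost two more.
  cover-lowerBound : ∀ {m} → (∀ X → IsVertexCover G X → m ≤ ∣ X ∣) →
                     ∀ X → IsVertexCover attachPath X → 2 + m ≤ ∣ X ∣
  cover-lowerBound {m} bound (x₀ ∷ x₁ ∷ x₂ ∷ x₃ ∷ x₄ ∷ X) cov =
    cardinality≥ (count (cov {b′} {a′} refl) (cov {b} {a} refl))
    where
    restricted : IsVertexCover G X
    restricted {u} {w} e with cov {old u} {old w} e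
    ... | inj₁ (old∈ p) = inj₁ p
    ... | inj₂ (old∈ p) = inj₂ p

    m≼X : m ≼ X
    m≼X = ⟨ bound X restricted ⟩

    count : ∀ {x₀ x₁ x₂ x₃ x₄} → let Y = x₀ ∷ x₁ ∷ x₂ ∷ x₃ ∷ x₄ ∷ X in
            b′ ∈ Y ⊎ a′ ∈ Y → b ∈ Y ⊎ a ∈ Y → (2 + m) ≼ Y
    -- Each match fixes one entry of the prefix as `inside`, counted by `keep`; `skip` passes over
    -- the entries left unknown.
    count (inj₁ b′∈) (inj₁ b∈) = keep (skip (keep (skip (skip m≼X))))
    count (inj₁ b′∈) (inj₂ a∈) = keep (skip (skip (skip (keep m≼X))))
    count (inj₂ a′∈) (inj₁ b∈) = skip (keep (keep (skip (skip m≼X))))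
    count (inj₂ a′∈) (inj₂ a∈) = skip (keep (skip (skip (keep m≼X))))

  dominatingExtension : Subset n → Subset (5 + n)
  dominatingExtension D = outside ∷ inside ∷ outside ∷ inside ∷ inside ∷ D

  -- The exempted `v` gets the new `a` as a neighbour. The conclusion exempts no vertex, so it also
  -- serves for total domination in `tree-γₜ`.
  dominatingExtension-total : ∀ {D} → DominatesAllBut G v D →
    ∀ u → HasNeighbourIn attachPath (dominatingExtension D) u
  dominatingExtension-total dom b′ = a′ , a′∈ , refl
  dominatingExtension-total dom a′ = c , c∈ , refl
  dominatingExtension-total dom b  = a , a∈ , refl
  dominatingExtension-total dom c  = a , a∈ , refl
  dominatingExtension-total dom a  = c , c∈ , refl
  dominatingExtension-total dom (old u) with u ≟ v
  ... | yes u≡v = a , a∈ , u≡v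
  ... | no  u≢v = let w , w∈D , u~w = dom u u≢v in old w , old∈ w∈D , u~w

  -- Among the old vertices only `v` is adjacent to a new one, namely `a`; exempting `v` therefore
  -- lets `D` restrict to `G`.
  dominating-lowerBound : ∀ {m} → (∀ D → DominatesAllBut G v D → m ≤ ∣ D ∣) →
                          ∀ D → DominatesAllBut attachPath a D → 3 + m ≤ ∣ D ∣
  dominating-lowerBound {m} bound (d₀ ∷ d₁ ∷ d₂ ∷ d₃ ∷ d₄ ∷ D) dom =
    cardinality≥ (count (dom b′ λ ()) (dom b λ ()) (dom a′ λ ()))
    where
    restricted : DominatesAllBut G v D
    restricted u u≢v with dom (old u) (λ ())
    ... | a     , _      , u≡v = contradiction u≡v u≢v
    ... | old w , old∈ p , u~w = w , p , u~w

    m≼D : m ≼ D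
    m≼D = ⟨ bound D restricted ⟩

    count : ∀ {d₀ d₁ d₂ d₃ d₄} → let E = d₀ ∷ d₁ ∷ d₂ ∷ d₃ ∷ d₄ ∷ D in
            HasNeighbourIn attachPath E b′ → HasNeighbourIn attachPath E b →
            HasNeighbourIn attachPath E a′ → (3 + m) ≼ E
    -- The leaves `b′` and `b` force `a′` and `a`; only the neighbour of `a′` leaves a choice, `b′`
    -- or `c`.
    count (a′ , a′∈ , _) (a , a∈ , _) (b′ , b′∈ , _) = keep (keep (skip (skip (keep m≼D))))
    count (a′ , a′∈ , _) (a , a∈ , _) (c , c∈ , _) = skip (keep (skip (keep (keep m≼D))))

-- With `k` on the left of the product, `suc k * 5` unfolds to `5 + k * 5`, so the vertex counts
-- match by computation.
tree : ∀ k → Graph (suc (k * 5))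
anchor : ∀ k → Fin (suc (k * 5))

tree zero    = singleton
tree (suc k) = attachPath (tree k) (anchor k)

anchor zero    = zero
anchor (suc k) = a

tree-isTree : ∀ k → IsTree (tree k)
tree-isTree zero    = singleton-isTree
tree-isTree (suc k) = attachPath-isTree (tree k) (anchor k) (tree-isTree k)

tree-τ : ∀ k → [ tree k ]τ≡ (k * 2)
tree-τ zero = (outside ∷ [] , (λ ()) , refl) , λ _ _ → z≤n
tree-τ (suc k) with tree-τ k
... | (X , cov , ∣X∣≡) , bound =
  ( coverExtension (tree k) (anchor k) X
  , (λ {u} {w} → coverExtension-cover (tree k) (anchor k) cov {u} {w})
  , cong (_+_ 2) ∣X∣≡) , cover-lowerBound (tree k) (anchor k) bound

tree-dominating : ∀ k → IsMinimumCardinality (DominatesAllBut (tree k) (anchor k)) (k * 3)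
tree-dominating zero =
  -- The only vertex is exempted, so the empty set works. The singleton has no total dominating set,
  -- so an induction on `γₜ` itself could not start here.
  (outside ∷ [] , (λ { zero 0≢0 → contradiction refl 0≢0 }) , refl) , λ _ _ → z≤n
tree-dominating (suc k) with tree-dominating k
... | (D , dom , ∣D∣≡) , bound =
  ( dominatingExtension (tree k) (anchor k) D
  , (λ u _ → dominatingExtension-total (tree k) (anchor k) dom u)
  , cong (_+_ 3) ∣D∣≡) , dominating-lowerBound (tree k) (anchor k) bound

totalDominating⇒hasNeighbour : ∀ {n} {G : Graph n} {D} → IsTotalDominating G D →
                               ∀ u → HasNeighbourIn G D u
totalDominating⇒hasNeighbour {D = D} (dominating , noIsolated) u with u ∈? D
... | yes u∈D = noIsolated u∈D
... | no  u∉D = dominating u∉D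

-- `tree-dominating (suc k)` supplies only the lower bound: its minimum set need not dominate the
-- anchor, so the witness is rebuilt from the one for `tree k`.
tree-γₜ : ∀ k → [ tree (suc k) ]γₜ≡ (suc k * 3)
tree-γₜ k with tree-dominating k | tree-dominating (suc k)
... | (D , dom , ∣D∣≡) , _ | _ , bound =
  ( dominatingExtension (tree k) (anchor k) D
  , ((λ {u} _ → total u) , (λ {u} _ → total u))
  , cong (_+_ 3) ∣D∣≡)
  , λ E td → bound E λ u _ → totalDominating⇒hasNeighbour {G = tree (suc k)} td u
  where
  total : ∀ u → HasNeighbourIn (tree (suc k)) (dominatingExtension (tree k) (anchor k) D) u
  total = dominatingExtension-total (tree k) (anchor k) dom

k*3-k*2≡k : ∀ k → + (k * 3) - + (k * 2) ≡ + k
k*3-k*2≡k k = begin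
  + (k * 3) - + (k * 2)     ≡⟨ cong (λ m → + m - + (k * 2)) (*-suc k 2) ⟩
  + (k + k * 2) - + (k * 2) ≡⟨ [+m]-[+n]≡m⊖n (k + k * 2) (k * 2) ⟩
  (k + k * 2) ⊖ (k * 2)     ≡⟨ ⊖-≥ (m≤n+m (k * 2) k) ⟩
  + (k + k * 2 ∸ k * 2)     ≡⟨ cong (+_) (m+n∸n≡m k (k * 2)) ⟩
  + k                       ∎
  where open ≡-Reasoning

proposition2 : ∀ (k : ℕ) .{{_ : NonZero k}} → ∃[ n ] Σ[ T ∈ Graph n ] (IsTree T × (∃[ γ ] ∃[ t ] ([ T ]γₜ≡ γ) × ([ T ]τ≡ t) × (+ γ) - (+ t) ≡ + k))
proposition2 (suc k) =
  _ , tree (suc k) , tree-isTree (suc k) ,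
  _ , _ , tree-γₜ k , tree-τ (suc k) , k*3-k*2≡k (suc k)
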